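{- Let $\nu$ be a lattice path from $(0,0)$ to $(\ell-n,n)$, and let $\mathrm{Tam}(\nu)$ be the $\nu$-Tamari lattice, viewed as the lattice of $\nu$-bracket vectors under the componentwise order. For every $\mathsf b\in\mathrm{Tam}(\nu)$, \[\mathrm{Row}(\mathsf b)=(\Theta_\ell\circ\cdots\circ\Theta_1\circ\Theta_0)(\mathsf b).\]
   Context: Intervals are integer intervals: $[a,b]=\{a,\dots,b\}$ (empty if $a>b$). Vectors are indexed from $0$. A lattice path uses unit north and unit east steps and starts at the origin. $\nu$-bracket vectors. Let $(b_0(\nu),\dots,b_\ell(\nu))$ be the heights ($y$-coordinates) of the lattice points of $\nu$ in the order they appear on $\nu$. For $0\le k\le n$, let $f_k$ be the largest index with $b_{f_k}(\nu)=k$; $f_0,\dots,f_n$ are the fixed positions of $\nu$. A $\nu$-bracket vector is an integer vector $\mathsf b=(\mathsf b_0,\dots,\mathsf b_\ell)$ such that (I) $\mathsf b_{f_k}=k$ for all $k\in[0,n]$; (II) $b_i(\nu)\le\mathsf b_i\le n$ for all $i\in[0,\ell]$; (III) if $\mathsf b_i=k$, then $\mathsf b_j\le k$ for all $j\in[i+1,f_k]$. The set $\mathrm{Tam}(\nu)$ of these, ordered componentwise, is a finite semidistributive lattice with meet the componentwise minimum. Rowmotion on a finite semidistributive lattice $L$. An element $j$ is join-irreducible if it covers exactly one element, denoted $j_*$; for such $j$, the set $\{z\in L:z\wedge j=j_*\}$ has a maximum, denoted $\kappa(j)$. For each cover relation $x\lessdot y$ there is a unique join-irreducible $j_{xy}$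 with $j_{xy}\le y$ and $\kappa(j_{xy})\ge x$. Put $\mathcal D(z)=\{j_{xz}:x\lessdot z\}$ and $\mathcal U(z)=\{j_{zy}:z\lessdot y\}$. For each $x\in L$ there is a unique element $\mathrm{Row}(x)\in L$ with $\mathcal U(\mathrm{Row}(x))=\mathcal D(x)$. The maps $\Theta_r$. For $\mathsf b\in\mathrm{Tam}(\nu)$ let $\Delta(\mathsf b)=\{i\in[0,\ell-1]:\mathsf b_i>\mathsf b_{i+1}\}$. For $i\in[0,\ell]$ let $\zeta_i(\mathsf b)=\min\{\mathsf b_j:j\in[0,i-1],\ \mathsf b_j\ge\mathsf b_i\}$, with $\zeta_i(\mathsf b)=n$ if this set is empty. For $i\in\Delta(\mathsf b)$ let $\eta_i(\mathsf b)=\max\{h\in[b_i(\nu),\mathsf b_i-1]:\mathsf b_j\le h\text{ for all }j\in[i+1,f_h]\}$ (this set is nonempty). Write $\mathsf b\leftarrow_i t$ for the vector obtained from $\mathsf b$ by replacing the entry in position $i$ by $t$. For $r\in[0,\ell]$, $\Theta_r\colon\mathrm{Tam}(\nu)\to\mathrm{Tam}(\nu)$ is defined by: $\Theta_r(\mathsf b)=\mathsf b$ if $r\in\{f_0,\dots,f_n\}$; $\Theta_r(\mathsf b)=\mathsf b\leftarrow_r\eta_r(\mathsf b)$ if $r\in\Delta(\mathsf b)$; $\Theta_r(\mathsf b)=\mathsf b\leftarrow_r\zeta_r(\mathsf b)$ if $r\notin\{f_0,\dots,f_n\}$ and $r\notin\Delta(\mathsf b)$. (No fixed position lies in $\Delta(\mathsf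 b)$.) -}

module Defs where

open import Data.Fin.Base as Fin using (Fin; zero; suc; inject₁; fromℕ; toℕ)
import Data.Fin.Properties as Fin
open import Data.List.Base using (List; allFin; filter; foldl; map; upTo)
import Data.List.Extrema as Extrema
open import Data.List.Extrema.Nat using (max; min; xs≤max; v≤max⁺; max≤v⁺; min≤xs; min≤⊤; v≤min⁺; argmax-sel; argmin-sel)
open import Data.List.Membership.Propositional using (_∈_)
open import Data.List.Membership.Propositional.Properties
  using (∈-allFin; ∈-filter⁺; ∈-filter⁻; ∈-map⁺; ∈-map⁻; ∈-upTo⁺; ∈-upTo⁻)
import Data.List.Relation.Unary.All as All
import Data.List.Relation.Unary.All.Properties as All
open import Data.Nat.Base hiding (_⊔_)
open import Data.Nat.Properties
open import Data.Product.Base using (Σ; ∃; _×_; _,_; proj₁; proj₂)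
open import Data.Product using (∃!)
open import Data.Sum.Base using (inj₁; inj₂; [_,_]′)
open import Data.Vec.Base using (Vec; []; _∷_)
open import Data.Vec.Functional using (Vector; updateAt; zipWith)
open import Data.Vec.Functional.Properties using (updateAt-updates; updateAt-minimal)
open import Function.Base using (const)
open import Level using (0ℓ; _⊔_)
open import Relation.Binary.Lattice.Bundles using (MeetSemilattice)
open import Relation.Binary.PropositionalEquality
open import Relation.Nullary using (¬_; Dec; yes; no; contradiction)
open import Relation.Nullary.Decidable using (_×-dec_; _→-dec_)
open import Relation.Unary using (Pred; _≐_)

------------------------------------------------------------------------
-- Rowmotion

-- Only the order and the meet enter the definition, so joins are not
-- required.  κ(j), j_{xy} and Row(x) exist and are unique when L is a
-- finite semidistributive lattice; they are given by their defining
-- properties, as relations.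

module Rowmotion {c ℓ₁ ℓ₂} (L : MeetSemilattice c ℓ₁ ℓ₂) where
  open MeetSemilattice L renaming (_≤_ to _⊑_)

  infix 4 _⊏_ _⋖_

  _⊏_ : Carrier → Carrier → Set (ℓ₁ ⊔ ℓ₂)
  x ⊏ y = x ⊑ y × ¬ (x ≈ y)

  _⋖_ : Carrier → Carrier → Set (c ⊔ ℓ₁ ⊔ ℓ₂)
  x ⋖ y = x ⊏ y × (∀ z → x ⊏ z → ¬ (z ⊏ y))

  JoinIrreducible : Pred Carrier (c ⊔ ℓ₁ ⊔ ℓ₂)
  JoinIrreducible j = ∃! _≈_ (_⋖ j)

  -- j_*
  lowerCover : ∀ {j} → JoinIrreducible j → Carrier
  lowerCover = proj₁

  -- k = κ(j)
  Isκ : ∀ {j} → JoinIrreducible j → Pred Carrier (c ⊔ ℓ₁ ⊔ ℓ₂)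
  Isκ {j} ji k = k ∧ j ≈ lowerCover ji × (∀ z → z ∧ j ≈ lowerCover ji → z ⊑ k)

  -- j = j_{xy}, for a cover x ⋖ y
  IsLabel : (x y j : Carrier) → Set (c ⊔ ℓ₁ ⊔ ℓ₂)
  IsLabel x y j =
    Σ (JoinIrreducible j) λ ji → j ⊑ y × (∃ λ k → Isκ ji k × x ⊑ k)

  𝒟 : Carrier → Pred Carrier (c ⊔ ℓ₁ ⊔ ℓ₂)
  𝒟 z j = ∃ λ x → x ⋖ z × IsLabel x z j

  𝒰 : Carrier → Pred Carrier (c ⊔ ℓ₁ ⊔ ℓ₂)
  𝒰 z j = ∃ λ y → z ⋖ y × IsLabel z y j

  -- Row(x) = y: y is the unique element with 𝒰(y) = 𝒟(x)
  IsRow : (x y : Carrier) → Set (c ⊔ ℓ₁ ⊔ ℓ₂)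
  IsRow x y = 𝒰 y ≐ 𝒟 x × (∀ z → 𝒰 z ≐ 𝒟 x → z ≈ y)

------------------------------------------------------------------------
-- Lattice paths

data Step : Set where
  north east : Step

move : Step → ℕ × ℕ → ℕ × ℕ
move north (x , y) = x , suc y
move east  (x , y) = suc x , y

walk : ∀ {ℓ} → ℕ × ℕ → Vec Step ℓ → Vector (ℕ × ℕ) (suc ℓ)
walk p ss       zero    = p
walk p (s ∷ ss) (suc i) = walk (move s p) ss i

record LatticePath (ℓ n : ℕ) : Set where
  field
    steps : Vec Step ℓ
  point : Vector (ℕ × ℕ) (suc ℓ)
  point = walk (0 , 0) steps
  field
    end : point (fromℕ ℓ) ≡ (ℓ ∸ n , n)

move-height : ∀ s p → proj₂ p ≤ proj₂ (move s p)
move-height north p = n≤1+n _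
move-height east  p = ≤-refl

walk-height : ∀ {ℓ} p (ss : Vec Step ℓ) (i : Fin ℓ) →
              proj₂ (walk p ss (inject₁ i)) ≤ proj₂ (walk p ss (suc i))
walk-height p (s ∷ ss) zero    = move-height s p
walk-height p (s ∷ ss) (suc i) = walk-height (move s p) ss i

walk-hits : ∀ {ℓ} p (ss : Vec Step ℓ) {k} → proj₂ p ≤ k →
            k ≤ proj₂ (walk p ss (fromℕ ℓ)) →
            ∃ λ i → proj₂ (walk p ss i) ≡ k
walk-hits p [] p≤k k≤e = zero , ≤-antisym p≤k k≤e
walk-hits p (s ∷ ss) {k} p≤k k≤e with proj₂ p ≟ k
... | yes p≡k = zero , p≡k
... | no  p≢k with walk-hits (move s p) ss (below s) k≤e
  where
  below : ∀ s → proj₂ (move s p) ≤ k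
  below north = ≤∧≢⇒< p≤k p≢k
  below east  = p≤k
... | i , eq = suc i , eq

------------------------------------------------------------------------
-- The ν-Tamari lattice

module Tamari {ℓ n : ℕ} (ν : LatticePath ℓ n) where
  open LatticePath ν

  -- b_i(ν)
  height : Vector ℕ (suc ℓ)
  height i = proj₂ (point i)

  -- f_k, the largest index of height k; for k > n there is no such index
  -- and the value is irrelevant.
  f : ℕ → Fin (suc ℓ)
  f k = Extrema.max (Fin.≤-totalOrder (suc ℓ)) zero
          (filter (λ i → height i ≟ k) (allFin (suc ℓ)))

  f-largest : ∀ {k} i → height i ≡ k → i Fin.≤ f k
  f-largest {k} i eq = All.lookup (Extrema.xs≤max (Fin.≤-totalOrder (suc ℓ)) zero _)
                         (∈-filter⁺ (λ i → height i ≟ k) (∈-allFin i) eq)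

  f-height : ∀ {k} → k ≤ n → height (f k) ≡ k
  f-height {k} k≤n
    with Extrema.argmax-sel (Fin.≤-totalOrder (suc ℓ)) (λ i → i) zero
           (filter (λ i → height i ≟ k) (allFin (suc ℓ)))
  ... | inj₂ f∈ = proj₂ (∈-filter⁻ (λ i → height i ≟ k) {xs = allFin (suc ℓ)} f∈)
  ... | inj₁ f≡0 with walk-hits (0 , 0) steps z≤n (subst (k ≤_) (sym (cong proj₂ end)) k≤n)
  ...   | i , eq = subst (λ j → height j ≡ k)
                     (trans (i≡0 i (subst (i Fin.≤_) f≡0 (f-largest i eq))) (sym f≡0)) eq
    where
    i≡0 : (i : Fin (suc ℓ)) → toℕ i ≤ 0 → i ≡ zero
    i≡0 zero _ = refl

  Fixed : Pred (Fin (suc ℓ)) 0ℓ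
  Fixed r = ∃ λ (k : Fin (suc n)) → f (toℕ k) ≡ r

  fixed? : ∀ r → Dec (Fixed r)
  fixed? r = Fin.any? λ k → f (toℕ k) Fin.≟ r

  record IsBracket (b : Vector ℕ (suc ℓ)) : Set where
    field
      fixed   : ∀ k → k ≤ n → b (f k) ≡ k
      lower   : ∀ i → height i ≤ b i
      upper   : ∀ i → b i ≤ n
      bracket : ∀ i j → i Fin.< j → j Fin.≤ f (b i) → b j ≤ b i

  record Tam : Set where
    constructor mkTam
    field
      vec       : Vector ℕ (suc ℓ)
      isBracket : IsBracket vec
    open IsBracket isBracket public

  open Tam using (vec; isBracket)

  infix 4 _≈ₜ_ _≤ₜ_

  _≈ₜ_ _≤ₜ_ : Tam → Tam → Set
  b ≈ₜ c = ∀ i → vec b i ≡ vec c i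
  b ≤ₜ c = ∀ i → vec b i ≤ vec c i

  _∧ₜ_ : Tam → Tam → Tam
  b ∧ₜ c = mkTam (zipWith _⊓_ (vec b) (vec c)) record
    { fixed   = λ k k≤n → trans (cong₂ _⊓_ (B.fixed k k≤n) (C.fixed k k≤n)) (⊓-idem k)
    ; lower   = λ i → ⊓-glb (B.lower i) (C.lower i)
    ; upper   = λ i → ≤-trans (m⊓n≤m _ _) (B.upper i)
    ; bracket = brk
    }
    where
    module B = Tam b
    module C = Tam c
    brk : ∀ i j → i Fin.< j → j Fin.≤ f (vec b i ⊓ vec c i) →
          vec b j ⊓ vec c j ≤ vec b i ⊓ vec c i
    brk i j i<j j≤f with ⊓-sel (vec b i) (vec c i)
    ... | inj₁ eq rewrite eq = ≤-trans (m⊓n≤m _ _) (B.bracket i j i<j j≤f)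
    ... | inj₂ eq rewrite eq = ≤-trans (m⊓n≤n _ _) (C.bracket i j i<j j≤f)

  tamari : MeetSemilattice 0ℓ 0ℓ 0ℓ
  tamari = record
    { Carrier = Tam
    ; _≈_     = _≈ₜ_
    ; _≤_     = _≤ₜ_
    ; _∧_     = _∧ₜ_
    ; isMeetSemilattice = record
      { isPartialOrder = record
        { isPreorder = record
          { isEquivalence = record
            { refl  = λ i → refl
            ; sym   = λ p i → sym (p i)
            ; trans = λ p q i → trans (p i) (q i)
            }
          ; reflexive = λ p i → ≤-reflexive (p i)
          ; trans     = λ p q i → ≤-trans (p i) (q i)
          }
        ; antisym = λ p q i → ≤-antisym (p i) (q i)
        }
      ; infimum = λ b c → (λ i → m⊓n≤m _ _) , (λ i → m⊓n≤n _ _)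
                        , (λ d p q i → ⊓-glb (p i) (q i))
      }
    }

  ----------------------------------------------------------------------
  -- The maps Θ_r

  -- r ∈ Δ(b); the witness i : Fin ℓ is r itself, seen in [0,ℓ-1].
  Descent : Vector ℕ (suc ℓ) → Pred (Fin (suc ℓ)) 0ℓ
  Descent b r = ∃ λ (i : Fin ℓ) → inject₁ i ≡ r × b (suc i) < b (inject₁ i)

  descent? : ∀ b r → Dec (Descent b r)
  descent? b r =
    Fin.any? λ i → (inject₁ i Fin.≟ r) ×-dec (b (suc i) <? b (inject₁ i))

  ζ-candidate? : ∀ (b : Vector ℕ (suc ℓ)) i j → Dec (j Fin.< i × b i ≤ b j)
  ζ-candidate? b i j = (j Fin.<? i) ×-dec (b i ≤? b j)

  -- Entries of a bracket vector are at most n, so taking the minimum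
  -- together with n only matters when there is no candidate.
  ζ : Vector ℕ (suc ℓ) → Fin (suc ℓ) → ℕ
  ζ b i = min n (map b (filter (ζ-candidate? b i) (allFin (suc ℓ))))

  Bounding : Vector ℕ (suc ℓ) → Fin (suc ℓ) → Pred ℕ 0ℓ
  Bounding b i h = height i ≤ h × (∀ j → i Fin.< j → j Fin.≤ f h → b j ≤ h)

  bounding? : ∀ b i h → Dec (Bounding b i h)
  bounding? b i h = (height i ≤? h) ×-dec
    Fin.all? λ j → (i Fin.<? j) →-dec ((j Fin.≤? f h) →-dec (b j ≤? h))

  -- upTo (b i) is [0, b i - 1].  Candidates are at least height i, so
  -- including height i in the maximum only matters when there are none,
  -- which does not happen at a descent of a bracket vector.
  η : Vector ℕ (suc ℓ) → Fin (suc ℓ) → ℕ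
  η b i = max (height i) (filter (bounding? b i) (upTo (b i)))

  infix 6 _[_]←_

  _[_]←_ : Vector ℕ (suc ℓ) → Fin (suc ℓ) → ℕ → Vector ℕ (suc ℓ)
  b [ i ]← t = updateAt b i (const t)

  -- Replacing a non-fixed entry r by t preserves bracket vectors, provided
  -- t obeys the bounds and is compatible with the entries before and after.
  update-isBracket : ∀ {b} → IsBracket b → ∀ r t → ¬ Fixed r →
    height r ≤ t → t ≤ n →
    (∀ i → i Fin.< r → r Fin.≤ f (b i) → t ≤ b i) →
    (∀ j → r Fin.< j → j Fin.≤ f t → b j ≤ t) →
    IsBracket (b [ r ]← t)
  update-isBracket {b} B r t ¬fix lo hi before after = record
    { fixed   = λ k k≤n → trans
        (other (λ eq → ¬fix (Fin.fromℕ< (s≤s k≤n) ,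
                             trans (cong f (Fin.toℕ-fromℕ< (s≤s k≤n))) eq)))
        (B.fixed k k≤n)
    ; lower   = λ i → pointwise (λ i v → height i ≤ v) lo B.lower i
    ; upper   = λ i → pointwise (λ i v → v ≤ n) hi B.upper i
    ; bracket = brk
    }
    where
    module B = IsBracket B
    b′ = b [ r ]← t

    same : b′ r ≡ t
    same = updateAt-updates r b

    other : ∀ {i} → i ≢ r → b′ i ≡ b i
    other {i} i≢r = updateAt-minimal i r b i≢r

    pointwise : (P : Fin (suc ℓ) → ℕ → Set) → P r t → (∀ i → P i (b i)) →
                ∀ i → P i (b′ i)
    pointwise P p q i with i Fin.≟ r
    ... | yes refl = subst (P i) (sym same) p
    ... | no  i≢r  = subst (P i) (sym (other i≢r)) (q i)

    brk : ∀ i j → i Fin.< j → j Fin.≤ f (b′ i) → b′ j ≤ b′ i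
    brk i j i<j j≤f with i Fin.≟ r | j Fin.≟ r
    ... | yes refl | yes refl = contradiction i<j (<-irrefl refl)
    ... | yes refl | no  j≢r rewrite same | other j≢r = after j i<j j≤f
    ... | no  i≢r  | yes refl rewrite same | other i≢r = before i i<j j≤f
    ... | no  i≢r  | no  j≢r rewrite other i≢r | other j≢r = B.bracket i j i<j j≤f

  module _ {b : Vector ℕ (suc ℓ)} (B : IsBracket b) where
    private module B = IsBracket B

    ζ-isBracket : ∀ r → ¬ Fixed r → IsBracket (b [ r ]← ζ b r)
    ζ-isBracket r ¬fix = update-isBracket B r (ζ b r) ¬fix
      (≤-trans (B.lower r) br≤ζ) (min≤⊤ n (map b xs)) before after
      where
      xs = filter (ζ-candidate? b r) (allFin (suc ℓ))

      br≤ζ : b r ≤ ζ b r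
      br≤ζ = v≤min⁺ (B.upper r) (All.map⁺ (All.tabulate λ j∈ →
        proj₂ (proj₂ (∈-filter⁻ (ζ-candidate? b r) {xs = allFin (suc ℓ)} j∈))))

      before : ∀ i → i Fin.< r → r Fin.≤ f (b i) → ζ b r ≤ b i
      before i i<r r≤f = All.lookup (min≤xs n (map b xs)) (∈-map⁺ b
        (∈-filter⁺ (ζ-candidate? b r) (∈-allFin i) (i<r , B.bracket i r i<r r≤f)))

      after : ∀ j → r Fin.< j → j Fin.≤ f (ζ b r) → b j ≤ ζ b r
      after j r<j j≤f = [ (λ eq → subst (b j ≤_) (sym eq) (B.upper j)) , from-entry ]′
        (argmin-sel (λ v → v) n (map b xs))
        where
        from-entry : ζ b r ∈ map b xs → b j ≤ ζ b r
        from-entry ζ∈ =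
          let i , i∈ , eq = ∈-map⁻ b ζ∈
              _ , i<r , _ = ∈-filter⁻ (ζ-candidate? b r) {xs = allFin (suc ℓ)} i∈
          in subst (b j ≤_) (sym eq)
               (B.bracket i j (<-trans i<r r<j) (subst (λ v → j Fin.≤ f v) eq j≤f))

    η-nonempty : ∀ r → Descent b r → ∃ λ h → h < b r × Bounding b r h
    η-nonempty _ (i , refl , d) = b (suc i) , d
      , ≤-trans (walk-height (0 , 0) steps i) (B.lower (suc i))
      , bound
      where
      bound : ∀ j → inject₁ i Fin.< j → j Fin.≤ f (b (suc i)) → b j ≤ b (suc i)
      bound j i<j j≤f with j Fin.≟ suc i
      ... | yes refl = ≤-refl
      ... | no  j≢   = B.bracket (suc i) j
        (≤∧≢⇒< (subst (λ m → suc m ≤ toℕ j) (Fin.toℕ-inject₁ i) i<j)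
               (λ eq → j≢ (sym (Fin.toℕ-injective eq)))) j≤f

    η-candidate : ∀ r → Descent b r → η b r < b r × Bounding b r (η b r)
    η-candidate r d = [ (λ eq → from-default eq (η-nonempty r d)) , member ]′
      (argmax-sel (λ v → v) (height r) xs)
      where
      xs = filter (bounding? b r) (upTo (b r))

      member : ∀ {h} → h ∈ xs → h < b r × Bounding b r h
      member h∈ = let h∈upTo , bd = ∈-filter⁻ (bounding? b r) {xs = upTo (b r)} h∈
                  in ∈-upTo⁻ h∈upTo , bd

      from-default : η b r ≡ height r → (∃ λ h → h < b r × Bounding b r h) →
                     η b r < b r × Bounding b r (η b r)
      from-default eq (h , h<br , bd) = subst (λ v → v < b r × Bounding b r v)
        (≤-antisym (All.lookup (xs≤max (height r) xs)
                     (∈-filter⁺ (bounding? b r) (∈-upTo⁺ h<br) bd))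
                   (subst (_≤ h) (sym eq) (proj₁ bd)))
        (h<br , bd)

    η-isBracket : ∀ r → ¬ Fixed r → Descent b r → IsBracket (b [ r ]← η b r)
    η-isBracket r ¬fix d =
      let η<br , lo , bd = η-candidate r d in
      update-isBracket B r (η b r) ¬fix lo
        (≤-trans (<⇒≤ η<br) (B.upper r))
        (λ i i<r r≤f → ≤-trans (<⇒≤ η<br) (B.bracket i r i<r r≤f))
        bd

  -- No fixed position is a descent, so testing for the former first is
  -- harmless.
  Θ-cases : ∀ r (b : Tam) → Dec (Fixed r) → Dec (Descent (vec b) r) → Tam
  Θ-cases r b (yes _)   _       = b
  Θ-cases r b (no ¬fix) (yes d) =
    mkTam (vec b [ r ]← η (vec b) r) (η-isBracket (isBracket b) r ¬fix d)
  Θ-cases r b (no ¬fix) (no _)  =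
    mkTam (vec b [ r ]← ζ (vec b) r) (ζ-isBracket (isBracket b) r ¬fix)

  Θ : Fin (suc ℓ) → Tam → Tam
  Θ r b = Θ-cases r b (fixed? r) (descent? (vec b) r)

  -- Θ_ℓ ∘ ⋯ ∘ Θ_1 ∘ Θ_0; a left fold applies Θ_0 first.
  Θ-all : Tam → Tam
  Θ-all b = foldl (λ c r → Θ r c) b (allFin (suc ℓ))

{-# OPTIONS --safe #-}

-- Write J(i,p) for the least bracket vector whose entry at i exceeds p; these
-- are the join-irreducibles.  A cover x ⋖ z changes a single entry i, and then
-- its label is J(i, x_i).  So 𝒟(b) consists of the J(i, η_i(b)) with i ∈ Δ(b),
-- while 𝒰(y) consists of the J(i, y_i) with i not fixed, y_i < n and y_i not
-- occurring before position i.  When Θ_ℓ ∘ ⋯ ∘ Θ_0 reaches a descent it writes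
-- η_i(b), a value that by the bracket condition has not occurred before;
-- at other non-fixed positions ζ writes n or repeats an earlier entry.  Finally,
-- reading from left to right, a bracket vector is determined by these J(i, y_i).

module Submission where

open import Defs
open import Data.Bool.Base using (if_then_else_)
open import Data.Fin.Base as Fin using (Fin; zero; suc; inject₁; toℕ)
open import Data.Fin.Induction using (<-wellFounded)
import Data.Fin.Properties as Fin
open import Data.List.Base using (List; []; _∷_; allFin; filter; foldl; map; upTo)
open import Data.List.Extrema.Nat using (xs≤max; argmin-sel)
open import Data.List.Membership.Propositional using (_∈_)
open import Data.List.Membership.Propositional.Properties
  using (∈-allFin; ∈-filter⁺; ∈-filter⁻; ∈-map⁻; ∈-upTo⁺)
open import Data.List.Relation.Unary.All as All using (All; []; _∷_)
open import Data.List.Relation.Unary.AllPairs using (AllPairs; _∷_)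
import Data.List.Relation.Unary.AllPairs.Properties as AllPairs
open import Data.List.Relation.Unary.Any using (here; there)
open import Data.Nat.Base using (ℕ; zero; suc; _≤_; _<_; _⊓_; z≤n; s≤s; s≤s⁻¹)
open import Data.Nat.Properties
open import Data.Product.Base using (∃; ∃₂; _×_; _,_; proj₁; proj₂)
open import Data.Sum.Base using (inj₁; inj₂)
open import Data.Vec.Base using (Vec; _∷_)
open import Data.Vec.Functional using (Vector)
open import Data.Vec.Functional.Properties using (updateAt-updates; updateAt-minimal)
open import Function.Base using (_∘_; id)
open import Induction.WellFounded using (Acc; acc)
open import Relation.Binary.Definitions using (tri<; tri≈; tri>)
open import Relation.Binary.PropositionalEquality
open import Relation.Nullary using (¬_; Dec; yes; no; does; contradiction)
open import Relation.Nullary.Decidable using (_×-dec_)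
open import Relation.Unary using (Pred; Decidable; _≐_)

-- Monotonicity of heights along a walk, and extremal witnesses.

walk-above : ∀ {ℓ} p (ss : Vec Step ℓ) i → proj₂ p ≤ proj₂ (walk p ss i)
walk-above p ss       zero    = ≤-refl
walk-above p (s ∷ ss) (suc i) = ≤-trans (move-height s p) (walk-above (move s p) ss i)

walk-mono : ∀ {ℓ} p (ss : Vec Step ℓ) {i j} → i Fin.≤ j →
            proj₂ (walk p ss i) ≤ proj₂ (walk p ss j)
walk-mono p ss       {zero}  {j}     _         = walk-above p ss j
walk-mono p (s ∷ ss) {suc i} {suc j} (s≤s i≤j) = walk-mono (move s p) ss i≤j

last-witness : ∀ {m p} {P : Pred (Fin m) p} → Decidable P → ∃ P →
               ∃ λ i → P i × (∀ j → i Fin.< j → ¬ P j)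
last-witness {m = suc m} P? (i , Pi) with Fin.any? (P? ∘ suc)
... | yes w = let j , Pj , after = last-witness (P? ∘ suc) w in
              suc j , Pj , λ { (suc k) (s≤s j<k) → after k j<k }
last-witness P? (zero , P0)   | no ∄ = zero , P0 , λ { (suc k) _ Pk → ∄ (k , Pk) }
last-witness P? (suc i , Pi)  | no ∄ = contradiction (i , Pi) ∄

least-witness : ∀ {p} {P : Pred ℕ p} → Decidable P → ∀ m → P m →
                ∃ λ k → k ≤ m × P k × (∀ {h} → h < k → ¬ P h)
least-witness P? m Pm with P? 0
... | yes P0 = 0 , z≤n , P0 , λ ()
least-witness P? zero    Pm | no ¬P0 = contradiction Pm ¬P0
least-witness P? (suc m) Pm | no ¬P0 =
  let k , k≤m , Pk , before = least-witness (P? ∘ suc) m Pm in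
  suc k , s≤s k≤m , Pk , λ { {zero} _ → ¬P0 ; {suc h} (s≤s h<k) → before h<k }

module _ {ℓ n : ℕ} (ν : LatticePath ℓ n) where
  open LatticePath ν
  open Tamari ν
  open Tam using (vec; isBracket; fixed; lower; upper; bracket)
  open Rowmotion tamari

  private
    Pos : Set
    Pos = Fin (suc ℓ)

  -- Heights and fixed positions.

  height-mono : ∀ {i j} → i Fin.≤ j → height i ≤ height j
  height-mono = walk-mono (0 , 0) steps

  height≤n : ∀ i → height i ≤ n
  height≤n i = subst (height i ≤_) (cong proj₂ end)
    (height-mono (subst (toℕ i ≤_) (sym (Fin.toℕ-fromℕ ℓ)) (s≤s⁻¹ (Fin.toℕ<n i))))

  -- Replaces the range up to `f k` in the bracket condition by a bound on heights; `height≤⇒≤f` is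
  -- the converse.
  ≤f⇒height≤ : ∀ {i k} → k ≤ n → i Fin.≤ f k → height i ≤ k
  ≤f⇒height≤ k≤n i≤f = ≤-trans (height-mono i≤f) (≤-reflexive (f-height k≤n))

  height≤⇒≤f : ∀ {i k} → k ≤ n → height i ≤ k → i Fin.≤ f k
  height≤⇒≤f {i} {k} k≤n h≤k with ≤-total (toℕ i) (toℕ (f k))
  ... | inj₁ i≤f = i≤f
  ... | inj₂ f≤i = f-largest i
    (≤-antisym h≤k (≤-trans (≤-reflexive (sym (f-height k≤n))) (height-mono f≤i)))

  f-fixed : ∀ {k} → k ≤ n → Fixed (f k)
  f-fixed k≤n = Fin.fromℕ< (s≤s k≤n) , cong f (Fin.toℕ-fromℕ< (s≤s k≤n))

  f-of-fixed : ∀ {i} → Fixed i → f (height i) ≡ i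
  f-of-fixed (k , refl) = cong f (f-height (s≤s⁻¹ (Fin.toℕ<n k)))

  fixed-entry : ∀ (b : Tam) {i} → Fixed i → vec b i ≡ height i
  fixed-entry b {i} fx = subst (λ j → vec b j ≡ height i) (f-of-fixed fx)
                           (fixed b (height i) (height≤n i))

  above-height⇒¬fixed : ∀ (b : Tam) {i} → height i < vec b i → ¬ Fixed i
  above-height⇒¬fixed b h<b fx = <-irrefl (sym (fixed-entry b fx)) h<b

  ≤ₜ-antisym : ∀ (b c : Tam) → b ≤ₜ c → c ≤ₜ b → b ≈ₜ c
  ≤ₜ-antisym b c p q i = ≤-antisym (p i) (q i)

  ≈ₜ-at : ∀ (b c : Tam) r → vec b r ≡ vec c r → (∀ i → i ≢ r → vec b i ≡ vec c i) → b ≈ₜ c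
  ≈ₜ-at b c r eq others i with i Fin.≟ r
  ... | yes refl = eq
  ... | no  i≢r  = others i i≢r

  _≈ₜ?_ : ∀ b c → Dec (b ≈ₜ c)
  b ≈ₜ? c = Fin.all? λ i → vec b i ≟ vec c i

  update-elim : ∀ {p} (P : Pos → ℕ → Set p) {b r t} → P r t →
                (∀ i → i ≢ r → P i (b i)) → ∀ i → P i ((b [ r ]← t) i)
  update-elim P {b} {r} {t} new old i with i Fin.≟ r
  ... | yes refl = subst (P i) (sym (updateAt-updates i b)) new
  ... | no  i≢r  = subst (P i) (sym (updateAt-minimal i r b i≢r)) (old i i≢r)

  -- Covers

  -- `η` in relational form: a relation is easier to transport between vectors than the computed
  -- maximum.
  Lowers : Vector ℕ (suc ℓ) → Pos → Pred ℕ _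
  Lowers b i h = h < b i × Bounding b i h × (∀ {g} → h < g → g < b i → ¬ Bounding b i g)

  lowers-unique : ∀ {b i g h} → Lowers b i g → Lowers b i h → g ≡ h
  lowers-unique {g = g} {h} (g<b , bdg , maxg) (h<b , bdh , maxh) with <-cmp g h
  ... | tri< g<h _ _ = contradiction bdh (maxg g<h h<b)
  ... | tri≈ _ g≡h _ = g≡h
  ... | tri> _ _ h<g = contradiction bdg (maxh h<g g<b)

  bounding-local : ∀ {b c i h} → (∀ j → i Fin.≤ j → b j ≡ c j) →
                   Bounding b i h → Bounding c i h
  bounding-local eq (lo , bd) = lo , λ j i<j j≤f →
    subst (_≤ _) (eq j (<⇒≤ i<j)) (bd j i<j j≤f)

  -- Allows `η` at `i` to be compared before and after earlier entries are overwritten, since only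
  -- entries from `i` on are involved.
  lowers-local : ∀ {b c i h} → (∀ j → i Fin.≤ j → b j ≡ c j) → Lowers b i h → Lowers c i h
  lowers-local {b} {c} {i} {h} eq (h<b , bd , maxi) =
    subst (h <_) bi≡ci h<b ,
    bounding-local eq bd ,
    λ h<g g<c bdg → maxi h<g (subst (_ <_) (sym bi≡ci) g<c)
                      (bounding-local (λ j i≤j → sym (eq j i≤j)) bdg)
    where
    bi≡ci : b i ≡ c i
    bi≡ci = eq i ≤-refl

  η-lowers : ∀ (b : Tam) {i} → Descent (vec b) i → Lowers (vec b) i (η (vec b) i)
  η-lowers b {i} d =
    let η<b , bd = η-candidate (isBracket b) i d in
    η<b , bd , λ η<g g<b bdg → <⇒≱ η<g
      (All.lookup (xs≤max (height i) (filter (bounding? (vec b) i) (upTo (vec b i))))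
        (∈-filter⁺ (bounding? (vec b) i) (∈-upTo⁺ g<b) bdg))

  bounding⇒¬fixed : ∀ (b : Tam) {i h} → h < vec b i → Bounding (vec b) i h → ¬ Fixed i
  bounding⇒¬fixed b h<b (lo , _) = above-height⇒¬fixed b (≤-<-trans lo h<b)

  -- As `height i ≤ h` and `i` is not fixed, `i` lies strictly before `f h`; hence the bound covers
  -- the next position, whose entry is at most `h`.
  bounding⇒descent : ∀ (b : Tam) {i h} → h < vec b i → Bounding (vec b) i h →
                     Descent (vec b) i
  bounding⇒descent b {i} {h} h<b bd@(lo , bound) =
    i′ , inject₁-i′ ,
    ≤-<-trans (bound (suc i′) (≤-reflexive (sym toℕ-suc-i′)) suc-i′≤f)
              (subst (λ j → h < vec b j) (sym inject₁-i′) h<b)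
    where
    h≤n : h ≤ n
    h≤n = ≤-trans (<⇒≤ h<b) (upper b i)
    i<f : i Fin.< f h
    i<f = ≤∧≢⇒< (height≤⇒≤f h≤n lo) λ eq →
      bounding⇒¬fixed b h<b bd (subst Fixed (sym (Fin.toℕ-injective eq)) (f-fixed h≤n))
    ℓ≢i : ℓ ≢ toℕ i
    ℓ≢i eq = <⇒≱ (≤-<-trans (≤-reflexive eq) i<f) (s≤s⁻¹ (Fin.toℕ<n (f h)))
    i′ : Fin ℓ
    i′ = Fin.lower₁ i ℓ≢i
    inject₁-i′ : inject₁ i′ ≡ i
    inject₁-i′ = Fin.inject₁-lower₁ i ℓ≢i
    toℕ-suc-i′ : suc (toℕ i′) ≡ suc (toℕ i)
    toℕ-suc-i′ = cong suc (trans (sym (Fin.toℕ-inject₁ i′)) (cong toℕ inject₁-i′))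
    suc-i′≤f : suc i′ Fin.≤ f h
    suc-i′≤f = subst (_≤ toℕ (f h)) (sym toℕ-suc-i′) i<f

  -- An earlier entry `h` would have `i` in its bracket range, because `height i ≤ h`, and so force
  -- `vec b i ≤ h`.
  lowers-fresh : ∀ (b : Tam) {i h} → Lowers (vec b) i h → ∀ j → j Fin.< i → vec b j ≢ h
  lowers-fresh b {i} {h} (h<b , (lo , _) , _) j j<i refl =
    <⇒≱ h<b (bracket b j i j<i (height≤⇒≤f (upper b j) lo))

  -- The explicit form of a cover `x ⋖ z`, by `drop⇒⋖` and `⋖⇒drop`.
  record Drop (x z : Tam) (i : Pos) : Set where
    field
      lowers : Lowers (vec z) i (vec x i)
      agrees : ∀ j → j ≢ i → vec x j ≡ vec z j

    drops : vec x i < vec z i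
    drops = proj₁ lowers

    ¬fixed : ¬ Fixed i
    ¬fixed = above-height⇒¬fixed z (≤-<-trans (lower x i) drops)

    below-n : vec x i < n
    below-n = <-≤-trans drops (upper z i)

    below : x ≤ₜ z
    below j with j Fin.≟ i
    ... | yes refl = <⇒≤ drops
    ... | no  j≢i  = ≤-reflexive (agrees j j≢i)

  drop-exists : ∀ (z : Tam) {i h} → Lowers (vec z) i h →
                ∃ λ x → Drop x z i × vec x i ≡ h
  drop-exists z {i} {h} low@(h<z , bd@(lo , bound) , _) = x , dropx , xi≡h
    where
    x : Tam
    x = mkTam (vec z [ i ]← h) (update-isBracket (isBracket z) i h
      (bounding⇒¬fixed z h<z bd) lo (≤-trans (<⇒≤ h<z) (upper z i))
      (λ j j<i i≤f → ≤-trans (<⇒≤ h<z) (bracket z j i j<i i≤f)) bound)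
    xi≡h : vec x i ≡ h
    xi≡h = updateAt-updates i (vec z)
    dropx : Drop x z i
    dropx = record
      { lowers = subst (Lowers (vec z) i) (sym xi≡h) low
      ; agrees = λ j j≢i → updateAt-minimal j i (vec z) j≢i
      }

  -- If i is the last entry where x and z differ, then lowering z at i as little
  -- as possible stays above x.
  drop-above : ∀ {x z} → x ⊏ z → ∃₂ λ w i → Drop w z i × x ≤ₜ w
  drop-above {x} {z} (x≤z , x≉z)
    with Fin.any? (λ i → vec x i <? vec z i)
  ... | no ∄ = contradiction
    (≤ₜ-antisym x z x≤z (λ i → ≮⇒≥ λ x<z → ∄ (i , x<z))) x≉z
  ... | yes w with last-witness (λ i → vec x i <? vec z i) w
  ...   | i , x<z , after =
    let w , d , _ = drop-exists z (η-lowers z (bounding⇒descent z x<z bd)) in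
    w , i , d , x≤drop d
    where
    -- After `i` the two vectors coincide, so condition (III) for `x` bounds the entries of `z`.
    bd : Bounding (vec z) i (vec x i)
    bd = lower x i , λ j i<j j≤f →
      ≤-trans (≮⇒≥ (after j i<j)) (bracket x i j i<j j≤f)
    x≤drop : ∀ {w} → Drop w z i → x ≤ₜ w
    x≤drop d j with j Fin.≟ i
    -- `w` takes the largest bounding value below `vec z i`, and `vec x i` is one.
    ... | yes refl = ≮⇒≥ λ w<x → proj₂ (proj₂ (Drop.lowers d)) w<x x<z bd
    ... | no  j≢i  = ≤-trans (x≤z j) (≤-reflexive (sym (Drop.agrees d j j≢i)))

  -- A vector strictly between would agree with both off `i`, and its entry at `i` would be a
  -- bounding value excluded by maximality.
  drop⇒⋖ : ∀ {x z i} → Drop x z i → x ⋖ z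
  drop⇒⋖ {x} {z} {i} d = (below , λ x≈z → <-irrefl (x≈z i) drops) , between
    where
    open Drop d
    between : ∀ w → x ⊏ w → ¬ (w ⊏ z)
    between w (x≤w , x≉w) (w≤z , w≉z) =
      proj₂ (proj₂ lowers)
        (≤∧≢⇒< (x≤w i) λ eq → x≉w (≈ₜ-at x w i eq
          (λ j j≢i → trans (agrees j j≢i) (sym (w≡z j j≢i)))))
        (≤∧≢⇒< (w≤z i) λ eq → w≉z (≈ₜ-at w z i eq w≡z))
        (lower w i , λ j i<j j≤f → subst (_≤ vec w i) (w≡z j (Fin.<⇒≢ i<j ∘ sym))
                       (bracket w i j i<j j≤f))
      where
      w≡z : ∀ j → j ≢ i → vec w j ≡ vec z j
      w≡z j j≢i = ≤-antisym (w≤z j) (subst (_≤ vec w j) (agrees j j≢i) (x≤w j))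

  ⋖⇒drop : ∀ {x z} → x ⋖ z → ∃ λ i → Drop x z i
  ⋖⇒drop {x} {z} (x⊏z , between) =
    let w , i , d , x≤w = drop-above {x} {z} x⊏z in i , equal d x≤w
    where
    equal : ∀ {w i} → Drop w z i → x ≤ₜ w → Drop x z i
    equal {w} {i} d x≤w with x ≈ₜ? w
    ... | no  x≉w = contradiction (proj₁ (drop⇒⋖ d)) (between w (x≤w , x≉w))
    ... | yes x≈w = record
      { lowers = subst (Lowers (vec z) i) (sym (x≈w i)) (Drop.lowers d)
      ; agrees = λ j j≢i → trans (x≈w j) (Drop.agrees d j j≢i)
      }

  -- Join-irreducibles

  -- Opaque, so that they do not reduce to boolean tests below.
  opaque
    -- As heights are weakly increasing, such an `a` has exactly the height of `i`.
    row? : ∀ i a → Dec (height i ≤ height a × a Fin.≤ i)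
    row? i a = (height i ≤? height a) ×-dec (a Fin.≤? i)

    is-fixed? : ∀ a → Dec (Fixed a)
    is-fixed? = fixed?

    cap? : ∀ (i : Pos) p a → Dec (i Fin.≤ a × height a ≤ p)
    cap? i p a = (i Fin.≤? a) ×-dec (height a ≤? p)

  -- J(i,p)
  gen : Pos → ℕ → Vector ℕ (suc ℓ)
  gen i p a = if does (row? i a) then suc p else height a

  gen-at : ∀ i p → gen i p i ≡ suc p
  gen-at i p with row? i i
  ... | yes _ = refl
  ... | no ¬r = contradiction (≤-refl , ≤-refl) ¬r

  gen-support : ∀ {i p a} → height a < gen i p a → a Fin.≤ i
  gen-support {i} {p} {a} h<g with row? i a
  ... | yes (_ , a≤i) = a≤i
  ... | no _          = contradiction h<g (<-irrefl refl)

  gen-after : ∀ {i p j} → i Fin.< j → gen i p j ≡ height j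
  gen-after {i} {p} {j} i<j with row? i j
  ... | yes (_ , j≤i) = contradiction j≤i (<⇒≱ i<j)
  ... | no _          = refl

  -- For `a` before `i` at the same height, condition (III) at `a` reaches `i` and makes the entry
  -- at `a` at least that at `i`.
  gen-least : ∀ {i p} (w : Tam) → suc p ≤ vec w i → ∀ a → gen i p a ≤ vec w a
  gen-least {i} {p} w p<w a with row? i a
  ... | no _ = lower w a
  ... | yes (h≤h , a≤i) with m≤n⇒m<n∨m≡n a≤i
  ...   | inj₁ a<i = ≤-trans p<w (bracket w a i a<i
                       (height≤⇒≤f (upper w a) (≤-trans h≤h (lower w a))))
  ...   | inj₂ a≡i = subst (λ j → suc p ≤ vec w j) (sym (Fin.toℕ-injective a≡i)) p<w

  -- `i` is recovered as the last position whose entry exceeds its height, and `p` from the entry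
  -- there.
  gen-injective : ∀ {i i′ p p′} → height i ≤ p → height i′ ≤ p′ →
                  (∀ a → gen i p a ≡ gen i′ p′ a) → i ≡ i′ × p ≡ p′
  gen-injective {i} {i′} {p} {p′} lo lo′ eq
    with Fin.toℕ-injective (≤-antisym
      (gen-support (subst (height i <_) (trans (sym (gen-at i p)) (eq i)) (s≤s lo)))
      (gen-support (subst (height i′ <_) (trans (sym (gen-at i′ p′)) (sym (eq i′))) (s≤s lo′))))
  ... | refl = refl , suc-injective (trans (sym (gen-at i p)) (trans (eq i) (gen-at i p′)))

  module JoinIrred {i p} (¬fix : ¬ Fixed i) (lo : height i ≤ p) (hi : p < n) where

    genₜ : Tam
    genₜ = mkTam (gen i p) record
      { fixed = fix ; lower = low ; upper = up ; bracket = brk }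
      where
      fix : ∀ k → k ≤ n → gen i p (f k) ≡ k
      fix k k≤n with row? i (f k)
      ... | no _ = f-height k≤n
      -- Such an `f k` is the last position of the height of `i`, so it would be `i` itself.
      ... | yes (h≤h , f≤i) = contradiction
        (subst Fixed (Fin.toℕ-injective (≤-antisym f≤i
          (height≤⇒≤f k≤n (≤-trans h≤h (≤-reflexive (f-height k≤n)))))) (f-fixed k≤n))
        ¬fix
      low : ∀ a → height a ≤ gen i p a
      low a with row? i a
      ... | yes (_ , a≤i) = ≤-trans (height-mono a≤i) (≤-trans lo (n≤1+n p))
      ... | no _          = ≤-refl
      up : ∀ a → gen i p a ≤ n
      up a with row? i a
      ... | yes _ = hi
      ... | no _  = height≤n a
      brk : ∀ a b → a Fin.< b → b Fin.≤ f (gen i p a) → gen i p b ≤ gen i p a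
      brk a b a<b b≤f with row? i a | row? i b
      ... | yes _ | yes _ = ≤-refl
      ... | yes _ | no _  = ≤f⇒height≤ hi b≤f
      ... | no ¬r | yes (h≤h , b≤i) = contradiction
        (≤-trans h≤h (≤f⇒height≤ (height≤n a) b≤f) , ≤-trans (<⇒≤ a<b) b≤i) ¬r
      ... | no _  | no _  = ≤f⇒height≤ (height≤n a) b≤f

    -- J(i,p)_*
    gen⁎ : Tam
    gen⁎ = mkTam (gen i p [ i ]← p) (update-isBracket (isBracket genₜ) i p ¬fix lo (<⇒≤ hi)
      (λ a a<i i≤f → ≤-trans (n≤1+n p)
        (subst (_≤ gen i p a) (gen-at i p) (bracket genₜ a i a<i i≤f)))
      (λ j i<j j≤f → subst (_≤ p) (sym (gen-after i<j)) (≤f⇒height≤ (<⇒≤ hi) j≤f)))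

    gen⁎-at : vec gen⁎ i ≡ p
    gen⁎-at = updateAt-updates i (gen i p)

    gen⁎-other : ∀ {a} → a ≢ i → vec gen⁎ a ≡ gen i p a
    gen⁎-other {a} a≢i = updateAt-minimal a i (gen i p) a≢i

    -- κ(J(i,p))
    cap : Vector ℕ (suc ℓ)
    cap a = if does (is-fixed? a) then height a else if does (cap? i p a) then p else n

    capₜ : Tam
    capₜ = mkTam cap record { fixed = fix ; lower = low ; upper = up ; bracket = brk }
      where
      fix : ∀ k → k ≤ n → cap (f k) ≡ k
      fix k k≤n with is-fixed? (f k)
      ... | yes _ = f-height k≤n
      ... | no ¬fx = contradiction (f-fixed k≤n) ¬fx
      low : ∀ a → height a ≤ cap a
      low a with is-fixed? a
      ... | yes _ = ≤-refl
      ... | no _ with cap? i p a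
      ...   | yes (_ , h≤p) = h≤p
      ...   | no _          = height≤n a
      up : ∀ a → cap a ≤ n
      up a with is-fixed? a
      ... | yes _ = height≤n a
      ... | no _ with cap? i p a
      ...   | yes _ = <⇒≤ hi
      ...   | no _  = ≤-refl
      brk : ∀ a b → a Fin.< b → b Fin.≤ f (cap a) → cap b ≤ cap a
      brk a b a<b b≤f with is-fixed? a
      -- The bracket range of a fixed position is empty.
      ... | yes fx = contradiction (subst (b Fin.≤_) (f-of-fixed fx) b≤f) (<⇒≱ a<b)
      ... | no _ with cap? i p a
      ...   | no _ = up b
      ...   | yes (i≤a , _) with ≤f⇒height≤ (<⇒≤ hi) b≤f
      ...     | h≤p with is-fixed? b
      ...       | yes _ = h≤p
      ...       | no _ with cap? i p b
      ...         | yes _ = ≤-refl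
      ...         | no ¬c = contradiction (≤-trans i≤a (<⇒≤ a<b) , h≤p) ¬c

    cap-at : cap i ≡ p
    cap-at with is-fixed? i
    ... | yes fx = contradiction fx ¬fix
    ... | no _ with cap? i p i
    ...   | yes _ = refl
    ...   | no ¬c = contradiction (≤-refl , lo) ¬c

    -- A raised entry other than `i` lies before `i` at the same height, so it is not fixed, and
    -- `cap` is `n` there.
    gen≤cap : ∀ a → a ≢ i → gen i p a ≤ cap a
    gen≤cap a a≢i with row? i a
    ... | no _ = lower capₜ a
    ... | yes (h≤h , a≤i) with is-fixed? a
    ...   | yes fx = contradiction
      (Fin.toℕ-injective (≤-antisym a≤i
        (subst (i Fin.≤_) (f-of-fixed fx) (height≤⇒≤f (height≤n a) h≤h)))) a≢i
    ...   | no _ with cap? i p a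
    ...     | yes (i≤a , _) = contradiction (Fin.toℕ-injective (≤-antisym a≤i i≤a)) a≢i
    ...     | no _ = hi

    -- Non-fixed positions after `i` of height at most `p` lie in the bracket range of `i`; at the
    -- others `cap` is as large as possible.
    cap-greatest : ∀ z → vec z i ≡ p → z ≤ₜ capₜ
    cap-greatest z refl a with is-fixed? a
    ... | yes fx = ≤-reflexive (fixed-entry z fx)
    ... | no _ with cap? i p a
    ...   | no _ = upper z a
    ...   | yes (i≤a , h≤p) with m≤n⇒m<n∨m≡n i≤a
    ...     | inj₁ i<a = bracket z i a i<a (height≤⇒≤f (<⇒≤ hi) h≤p)
    ...     | inj₂ i≡a = ≤-reflexive (cong (vec z) (sym (Fin.toℕ-injective i≡a)))

    -- Labels are determined only up to `≈ₜ`, as bracket vectors carry proofs; hence an arbitrary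
    -- `j` with these entries instead of `genₜ`.
    module _ {j : Tam} (j≗gen : ∀ a → vec j a ≡ gen i p a) where

      j-at : vec j i ≡ suc p
      j-at = trans (j≗gen i) (gen-at i p)

      j-least : ∀ w → suc p ≤ vec w i → j ≤ₜ w
      j-least w p<w a = subst (_≤ vec w a) (sym (j≗gen a)) (gen-least w p<w a)

      -- If the entry of `y` at `i` exceeded `p`, leastness of `j` would give `j ≤ₜ y`. This makes
      -- `gen⁎` the only lower cover of `j`.
      below-j : ∀ {y} → y ⊏ j → y ≤ₜ gen⁎
      below-j {y} (y≤j , y≉j) = update-elim (λ a v → vec y a ≤ v)
        (≮⇒≥ λ p<y → y≉j (≤ₜ-antisym y j y≤j (j-least y p<y)))
        (λ a _ → subst (vec y a ≤_) (j≗gen a) (y≤j a))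

      gen⁎⊏j : gen⁎ ⊏ j
      gen⁎⊏j = update-elim (λ a v → v ≤ vec j a)
                 (≤-trans (n≤1+n p) (≤-reflexive (sym j-at)))
                 (λ a _ → ≤-reflexive (sym (j≗gen a)))
             , λ eq → <-irrefl (trans (sym gen⁎-at) (trans (eq i) j-at)) ≤-refl

      joinIrreducible : JoinIrreducible j
      joinIrreducible = gen⁎ , (gen⁎⊏j , no-between) , λ {y} → unique {y}
        where
        no-between : ∀ y → gen⁎ ⊏ y → ¬ (y ⊏ j)
        no-between y (g≤y , g≉y) y⊏j =
          g≉y (≤ₜ-antisym gen⁎ y g≤y (below-j {y} y⊏j))
        unique : ∀ {y} → y ⋖ j → gen⁎ ≈ₜ y
        unique {y} (y⊏j , between) with y ≈ₜ? gen⁎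
        ... | yes y≈g = λ a → sym (y≈g a)
        ... | no  y≉g = contradiction gen⁎⊏j (between gen⁎ (below-j {y} y⊏j , y≉g))

      -- Off `i` the meet is `gen` by `gen≤cap`. Conversely, a meet with entry `p` at `i`, where `j`
      -- has `suc p`, forces `vec z i ≡ p`.
      isκ : Isκ {j} joinIrreducible capₜ
      isκ = meet , greatest
        where
        meet : (capₜ ∧ₜ j) ≈ₜ gen⁎
        meet a with a Fin.≟ i
        ... | yes refl = trans (cong₂ _⊓_ cap-at j-at)
                           (trans (m≤n⇒m⊓n≡m (n≤1+n p)) (sym gen⁎-at))
        ... | no  a≢i  = trans (cong (cap a ⊓_) (j≗gen a))
                           (trans (m≥n⇒m⊓n≡n (gen≤cap a a≢i)) (sym (gen⁎-other a≢i)))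
        greatest : ∀ z → (z ∧ₜ j) ≈ₜ gen⁎ → z ≤ₜ capₜ
        greatest z eq = cap-greatest z (entry (trans (cong (vec z i ⊓_) (sym j-at))
                                                (trans (eq i) gen⁎-at)))
          where
          entry : vec z i ⊓ suc p ≡ p → vec z i ≡ p
          entry e with ⊓-sel (vec z i) (suc p)
          ... | inj₁ s = trans (sym s) e
          ... | inj₂ s = contradiction (trans (sym s) e) 1+n≢n

  -- Labels of covers

  drop⇒label : ∀ {x z i j} → Drop x z i → (∀ a → vec j a ≡ gen i (vec x i) a) → IsLabel x z j
  drop⇒label {x} {z} {i} {j} d j≗gen =
    joinIrreducible {j} j≗gen , j-least {j} j≗gen z drops ,
    capₜ , isκ {j} j≗gen , cap-greatest x refl
    where
    open Drop d
    open JoinIrred ¬fixed (lower x i) below-n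

  -- Uniqueness of the label: `j` lies above the generator, and if strictly, then its lower cover,
  -- the meet of `k` and `j`, does too. Then `k` exceeds `vec x i` at `i`, against `k≤x`.
  label⇒gen : ∀ {x z i j} → Drop x z i → IsLabel x z j → ∀ a → vec j a ≡ gen i (vec x i) a
  label⇒gen {x} {z} {i} {j} d (ji , j≤z , k , (k∧j≈j⁎ , _) , x≤k) = j≈gen
    where
    open Drop d
    open JoinIrred ¬fixed (lower x i) below-n

    j⁎ : Tam
    j⁎ = lowerCover {j} ji

    j≰k : ¬ (j ≤ₜ k)
    j≰k j≤k with proj₁ (proj₂ ji)
    ... | (j⁎≤j , j⁎≉j) , _ = j⁎≉j (≤ₜ-antisym j⁎ j j⁎≤j
      λ a → subst (vec j a ≤_) (k∧j≈j⁎ a) (⊓-glb (j≤k a) ≤-refl))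

    x<j : vec x i < vec j i
    x<j = ≰⇒> λ j≤x → j≰k λ a → ≤-trans (j≤x⇒ j≤x a) (x≤k a)
      where
      j≤x⇒ : vec j i ≤ vec x i → j ≤ₜ x
      j≤x⇒ j≤x a with a Fin.≟ i
      ... | yes refl = j≤x
      ... | no  a≢i  = ≤-trans (j≤z a) (≤-reflexive (sym (agrees a a≢i)))

    k≤x : vec k i ≤ vec x i
    k≤x = ≮⇒≥ λ x<k → j≰k λ a → ≤-trans (j≤z a) (z≤k x<k a)
      where
      z≤k : vec x i < vec k i → z ≤ₜ k
      z≤k x<k a with a Fin.≟ i
      ... | no  a≢i  = ≤-trans (≤-reflexive (sym (agrees a a≢i))) (x≤k a)
      -- Otherwise `vec k i` would be a bounding value strictly between `vec x i` and `vec z i`.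
      ... | yes refl = ≮⇒≥ λ k<z → proj₂ (proj₂ lowers) x<k k<z
        (lower k a , λ b a<b b≤f →
          ≤-trans (≤-reflexive (sym (agrees b (Fin.<⇒≢ a<b ∘ sym))))
            (≤-trans (x≤k b) (bracket k a b a<b b≤f)))

    j≈gen : j ≈ₜ genₜ
    j≈gen with genₜ ≈ₜ? j
    ... | yes g≈j = λ a → sym (g≈j a)
    ... | no  g≉j = contradiction k≤x (<⇒≱ x<k)
      where
      open ≤-Reasoning
      x<k : vec x i < vec k i
      x<k = let w , _ , e , g≤w = drop-above {genₜ} {j} (gen-least j x<j , g≉j) in begin-strict
        vec x i             <⟨ n<1+n (vec x i) ⟩
        suc (vec x i)       ≡⟨ gen-at i (vec x i) ⟨
        gen i (vec x i) i   ≤⟨ g≤w i ⟩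
        vec w i             ≡⟨ proj₂ (proj₂ ji) {w} (drop⇒⋖ e) i ⟨
        vec j⁎ i            ≡⟨ k∧j≈j⁎ i ⟨
        vec k i ⊓ vec j i   ≤⟨ m⊓n≤m _ _ ⟩
        vec k i             ∎

  -- Down-labels and up-labels in terms of positions.

  𝒟-drop : ∀ {z j} → 𝒟 z j → ∃₂ λ x i → Drop x z i × (∀ a → vec j a ≡ gen i (vec x i) a)
  𝒟-drop {z} {j} (x , x⋖z , lab) =
    let i , d = ⋖⇒drop {x} {z} x⋖z in x , i , d , label⇒gen {j = j} d lab

  drop-𝒟 : ∀ {x z i j} → Drop x z i → (∀ a → vec j a ≡ gen i (vec x i) a) → 𝒟 z j
  drop-𝒟 {x} {j = j} d eq = x , drop⇒⋖ d , drop⇒label {j = j} d eq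

  -- The positions at which an upper cover of `z` raises an entry, by `drop⇒new` and `new⇒drop`.
  record New (z : Tam) (i : Pos) : Set where
    constructor new
    field
      ¬fixed  : ¬ Fixed i
      below-n : vec z i < n
      fresh   : ∀ j → j Fin.< i → vec z j ≢ vec z i

  drop⇒new : ∀ {x z i} → Drop x z i → New x i
  drop⇒new {x} {z} {i} d = new ¬fixed below-n λ j j<i eq →
    lowers-fresh z lowers j j<i (trans (sym (agrees j (Fin.<⇒≢ j<i))) eq)
    where open Drop d

  -- The entry at i is raised to the least larger value allowed by the later
  -- entries; the earlier ones then allow it as well.
  new⇒drop : ∀ {z i} → New z i → ∃ λ w → Drop z w i
  new⇒drop {z} {i} (new ¬fix z<n fresh)
    with least-witness (λ t → (vec z i <? t) ×-dec bounding? (vec z) i t) n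
           (z<n , height≤n i , λ j _ _ → upper z j)
  ... | t , t≤n , (z<t , bd@(lo , bound)) , least = w , record
    { lowers = subst (vec z i <_) (sym w-at) z<t
             , (lower z i , λ j i<j j≤f → subst (_≤ vec z i) (sym (w-other (Fin.<⇒≢ i<j ∘ sym)))
                                            (bracket z i j i<j j≤f))
             , λ {g} z<g g<w (lo′ , bound′) → least (subst (g <_) w-at g<w)
                 (z<g , lo′ , λ j i<j j≤f → subst (_≤ g) (w-other (Fin.<⇒≢ i<j ∘ sym))
                                              (bound′ j i<j j≤f))
    ; agrees = λ j j≢i → sym (w-other j≢i)
    }
    where
    before : ∀ j → j Fin.< i → i Fin.≤ f (vec z j) → t ≤ vec z j
    -- By freshness this earlier entry exceeds `vec z i`, and it bounds the later entries in its
    -- range, so it competes with the least value `t`.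
    before j j<i i≤f = ≮⇒≥ λ z<t′ → least z<t′
      ( ≤∧≢⇒< (bracket z j i j<i i≤f) (fresh j j<i ∘ sym)
      , ≤f⇒height≤ (upper z j) i≤f
      , λ b i<b b≤f → bracket z j b (<-trans j<i i<b) b≤f)
    w : Tam
    w = mkTam (vec z [ i ]← t) (update-isBracket (isBracket z) i t ¬fix lo t≤n before bound)
    w-at : vec w i ≡ t
    w-at = updateAt-updates i (vec z)
    w-other : ∀ {j} → j ≢ i → vec w j ≡ vec z j
    w-other {j} j≢i = updateAt-minimal j i (vec z) j≢i

  𝒰-new : ∀ {z j} → 𝒰 z j → ∃ λ i → New z i × (∀ a → vec j a ≡ gen i (vec z i) a)
  𝒰-new {z} {j} (w , z⋖w , lab) =
    let i , d = ⋖⇒drop {z} {w} z⋖w in i , drop⇒new d , label⇒gen {j = j} d lab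

  new-𝒰 : ∀ {z i j} → New z i → (∀ a → vec j a ≡ gen i (vec z i) a) → 𝒰 z j
  new-𝒰 {j = j} nw eq =
    let w , d = new⇒drop nw in w , drop⇒⋖ d , drop⇒label {j = j} d eq

  -- A bracket vector is determined by its first occurrences

  -- The label J(i, y_i) also labels an upper cover of `z`, and `gen-injective` recovers both the
  -- position and the value.
  𝒰⊆⇒new-agree : ∀ {y z} → (∀ {j} → 𝒰 y j → 𝒰 z j) → ∀ {i} → New y i → vec y i ≡ vec z i
  𝒰⊆⇒new-agree {y} {z} sub {i} nw@(new ¬fix y<n _) =
    let i′ , _ , eq = 𝒰-new {z} {genₜ} (sub {genₜ} (new-𝒰 {j = genₜ} nw λ _ → refl))
        i≡i′ , y≡z = gen-injective (lower y i) (lower z i′) eq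
    in trans y≡z (cong (vec z) (sym i≡i′))
    where open JoinIrred ¬fix (lower y i) y<n

  -- Either `vec y i` is new and the entries agree, or it repeats an earlier entry shared with `z`,
  -- and condition (III) for `z` bounds `vec z i` by it.
  not-below : ∀ {y z} → (∀ {i} → New y i → vec y i ≡ vec z i) →
              ∀ {i} → (∀ j → j Fin.< i → vec y j ≡ vec z j) → ¬ (vec y i < vec z i)
  not-below {y} {z} agree {i} prefix y<z
    with Fin.any? (λ j → (j Fin.<? i) ×-dec (vec y j ≟ vec y i))
  ... | no ∄ = <-irrefl (agree (new ¬fix (<-≤-trans y<z (upper z i))
                  λ j j<i eq → ∄ (j , j<i , eq))) y<z
    where
    ¬fix : ¬ Fixed i
    ¬fix = above-height⇒¬fixed z (≤-<-trans (lower y i) y<z)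
  ... | yes (j , j<i , eq) = <⇒≱ y<z (subst (vec z i ≤_) zj≡yi
    (bracket z j i j<i (height≤⇒≤f (upper z j) (subst (height i ≤_) (sym zj≡yi) (lower y i)))))
    where
    zj≡yi : vec z j ≡ vec y i
    zj≡yi = trans (sym (prefix j j<i)) eq

  𝒰-injective : ∀ y z → 𝒰 y ≐ 𝒰 z → y ≈ₜ z
  𝒰-injective y z (y⊆z , z⊆y) i = go i (<-wellFounded i)
    where
    go : ∀ i → Acc Fin._<_ i → vec y i ≡ vec z i
    go i (acc rec) with <-cmp (vec y i) (vec z i)
    ... | tri< y<z _ _ = contradiction y<z
      (not-below {y} {z} (𝒰⊆⇒new-agree {y} {z} λ {j} → y⊆z {j}) λ j j<i → go j (rec j<i))
    ... | tri≈ _ eq _  = eq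
    ... | tri> _ _ z<y = contradiction z<y
      (not-below {z} {y} (𝒰⊆⇒new-agree {z} {y} λ {j} → z⊆y {j}) λ j j<i → sym (go j (rec j<i)))

  -- The maps Θ_r

  Θ-other : ∀ r c {i} → i ≢ r → vec (Θ r c) i ≡ vec c i
  Θ-other r c {i} i≢r with fixed? r
  ... | yes _ = refl
  ... | no _ with descent? (vec c) r
  ...   | yes _ = updateAt-minimal i r (vec c) i≢r
  ...   | no _  = updateAt-minimal i r (vec c) i≢r

  Θ-descent : ∀ r c → ¬ Fixed r → Descent (vec c) r → vec (Θ r c) r ≡ η (vec c) r
  Θ-descent r c ¬fix d with fixed? r
  ... | yes fx = contradiction fx ¬fix
  ... | no _ with descent? (vec c) r
  ...   | yes _ = updateAt-updates r (vec c)
  ...   | no ¬d = contradiction d ¬d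

  Θ-ascent : ∀ r c → ¬ Fixed r → ¬ Descent (vec c) r → vec (Θ r c) r ≡ ζ (vec c) r
  Θ-ascent r c ¬fix ¬d with fixed? r
  ... | yes fx = contradiction fx ¬fix
  ... | no _ with descent? (vec c) r
  ...   | yes d = contradiction d ¬d
  ...   | no _  = updateAt-updates r (vec c)

  ζ-earlier : ∀ (b : Tam) i → ζ (vec b) i < n → ∃ λ j → j Fin.< i × vec b j ≡ ζ (vec b) i
  ζ-earlier b i ζ<n
    with argmin-sel id n (map (vec b) (filter (ζ-candidate? (vec b) i) (allFin (suc ℓ))))
  ... | inj₁ ζ≡n = contradiction ζ<n (<-irrefl ζ≡n)
  ... | inj₂ ζ∈ with ∈-map⁻ (vec b) ζ∈
  ...   | j , j∈ , eq = j , proj₁ (proj₂ (∈-filter⁻ (ζ-candidate? (vec b) i)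
                                           {xs = allFin (suc ℓ)} j∈)) , sym eq

  private
    Θs : List Pos → Tam → Tam
    Θs rs b = foldl (λ c r → Θ r c) b rs

  Θs-untouched : ∀ {rs i} b → All (i Fin.<_) rs → vec (Θs rs b) i ≡ vec b i
  Θs-untouched         b []         = refl
  Θs-untouched {r ∷ _} b (i<r ∷ is) =
    trans (Θs-untouched (Θ r b) is) (Θ-other r b (Fin.<⇒≢ i<r))

  -- `c` is the result of the maps preceding `r`. In an increasing list these change only positions
  -- before `r`, and the maps following `r` only positions after it.
  Θs-stage : ∀ {rs r} b → AllPairs Fin._<_ rs → r ∈ rs → ∃ λ c →
             (∀ i → r Fin.≤ i → vec c i ≡ vec b i) ×
             (∀ i → i Fin.≤ r → vec (Θs rs b) i ≡ vec (Θ r c) i)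
  Θs-stage {r ∷ _} b (r<rs ∷ _) (here refl) =
    b , (λ _ _ → refl) , λ i i≤r → Θs-untouched (Θ r b) (All.map (≤-<-trans i≤r) r<rs)
  Θs-stage {s ∷ _} b (s<rs ∷ sorted) (there r∈) =
    let c , later , earlier = Θs-stage (Θ s b) sorted r∈ in
    c , (λ i r≤i → trans (later i r≤i)
          (Θ-other s b (Fin.<⇒≢ (<-≤-trans (All.lookup s<rs r∈) r≤i) ∘ sym)))
      , earlier

  -- c is the vector to which Θ_r is applied in the computation of y from b.
  record Stage (b y : Tam) (r : Pos) : Set where
    field
      c       : Tam
      later   : ∀ i → r Fin.≤ i → vec c i ≡ vec b i
      earlier : ∀ i → i Fin.< r → vec y i ≡ vec c i
      at      : vec y r ≡ vec (Θ r c) r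

  Θ-stage : ∀ b r → Stage b (Θ-all b) r
  Θ-stage b r =
    let c , later , earlier = Θs-stage b (AllPairs.tabulate⁺-< id) (∈-allFin r) in record
    { c       = c
    ; later   = later
    ; earlier = λ i i<r → trans (earlier i (<⇒≤ i<r)) (Θ-other r c (Fin.<⇒≢ i<r))
    ; at      = earlier r ≤-refl
    }

  -- Rowmotion from the stages.

  module _ {b y : Tam} {i : Pos} (stage : Stage b y i) where
    open Stage stage

    -- A new entry must come from `η`: a value of `ζ` below `n` repeats an earlier entry of `c`,
    -- which is still present in `y`.
    new⇒lowers : New y i → Lowers (vec b) i (vec y i)
    new⇒lowers (new ¬fix y<n fresh) = by-cases (descent? (vec c) i)
      where
      by-cases : Dec (Descent (vec c) i) → Lowers (vec b) i (vec y i)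
      by-cases (yes d) = lowers-local later (subst (Lowers (vec c) i)
                           (sym (trans at (Θ-descent i c ¬fix d))) (η-lowers c d))
      by-cases (no ¬d) =
        let y≡ζ = trans at (Θ-ascent i c ¬fix ¬d)
            j , j<i , cj≡ζ = ζ-earlier c i (subst (_< n) y≡ζ y<n)
        in contradiction (trans (earlier j j<i) (trans cj≡ζ (sym y≡ζ))) (fresh j j<i)

    -- From `i` on the stage still has the entries of `b`, so `η` writes `h`; the earlier entries
    -- are already final and avoid `h` by `lowers-fresh`.
    lowers⇒new : ∀ {h} → Lowers (vec b) i h → New y i × vec y i ≡ h
    lowers⇒new {h} low = new ¬fix y<n fresh , y≡h
      where
      low-c : Lowers (vec c) i h
      low-c = lowers-local (λ j i≤j → sym (later j i≤j)) low
      h<c : h < vec c i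
      h<c = proj₁ low-c
      ¬fix : ¬ Fixed i
      ¬fix = bounding⇒¬fixed c h<c (proj₁ (proj₂ low-c))
      d : Descent (vec c) i
      d = bounding⇒descent c h<c (proj₁ (proj₂ low-c))
      y≡h : vec y i ≡ h
      y≡h = trans at (trans (Θ-descent i c ¬fix d) (lowers-unique (η-lowers c d) low-c))
      y<n : vec y i < n
      y<n = subst (_< n) (sym y≡h) (<-≤-trans h<c (upper c i))
      fresh : ∀ j → j Fin.< i → vec y j ≢ vec y i
      fresh j j<i eq = lowers-fresh c low-c j j<i
        (trans (sym (earlier j j<i)) (trans eq y≡h))

  -- New positions of `y` and drops of `b` match with the same position and value, hence the same
  -- label; uniqueness is `𝒰-injective`.
  stages⇒row : ∀ {b y} → (∀ i → Stage b y i) → IsRow b y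
  stages⇒row {b} {y} stage = ((λ {j} → 𝒰⊆𝒟 {j}) , λ {j} → 𝒟⊆𝒰 {j}) , λ z (z⊆ , ⊆z) →
    𝒰-injective z y ((λ {j} u → 𝒟⊆𝒰 {j} (z⊆ {j} u)) , λ {j} u → ⊆z {j} (𝒰⊆𝒟 {j} u))
    where
    𝒰⊆𝒟 : ∀ {j} → 𝒰 y j → 𝒟 b j
    𝒰⊆𝒟 {j} u =
      let i , nw , eq = 𝒰-new {y} {j} u
          x , d , x≡y = drop-exists b (new⇒lowers (stage i) nw)
      in drop-𝒟 {j = j} d λ a → trans (eq a) (cong (λ p → gen i p a) (sym x≡y))
    𝒟⊆𝒰 : ∀ {j} → 𝒟 b j → 𝒰 y j
    𝒟⊆𝒰 {j} dj =
      let x , i , d , eq = 𝒟-drop {b} {j} dj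
          nw , y≡x = lowers⇒new (stage i) (Drop.lowers d)
      in new-𝒰 {j = j} nw λ a → trans (eq a) (cong (λ p → gen i p a) (sym y≡x))

theorem4p2 : ∀ {ℓ n : ℕ} (ν : LatticePath ℓ n) (b : Tamari.Tam ν) →
    Rowmotion.IsRow (Tamari.tamari ν) b (Tamari.Θ-all ν b)
theorem4p2 ν b = stages⇒row ν (Θ-stage ν b)
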